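{- Let the canonical Tribonacci representation of $n-1$ be $e_1\cdots e_i$, that of $n-2$ be $f_1\cdots f_j$, and that of $n-4$ be $g_1\cdots g_k$ (each padded with leading zeros if necessary). Then $$N_a(n)=[e_1\cdots e_{i-1}]_T+1\quad(n\ge1),$$ $$N_b(n)=[f_1\cdots f_{j-2}]_T+1\quad(n\ge2),$$ $$N_c(n)=[g_1\cdots g_{k-3}]_T+1\quad(n\ge4).$$
   Context: Tribonacci numbers: $T_{ -3}=T_{ -2}=0$, $T_{ -1}=1$, $T_n=T_{n-1}+T_{n-2}+T_{n-3}$ for $n\ge0$ (so $T_0=1,T_1=2,T_2=4,T_3=7$). For a finite binary string $E=e_1\cdots e_i$, $[E]_T=\sum_{1\le j\le i}e_jT_{i-j}$ (the empty string has value $0$). The canonical Tribonacci representation of an integer $m\ge0$ is the binary string with value $m$ obtained by the greedy algorithm (repeatedly subtracting the largest possible Tribonacci number), least significant digit on the right; up to leading zeros it is the unique binary string $E$ with $[E]_T=m$ containing no three consecutive $1$'s. The Tribonacci word $\mathbf T=t_1t_2t_3\cdots$ is the infinite fixed point, beginning with $a$, of the morphism $\tau: a\to ab,\ b\to ac,\ c\to a$. For $n\ge1$, $N_a(n),N_b(n),N_c(n)$ are the numbers of $a$'s, $b$'s, $c$'s in $t_1\cdots t_n$. -}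

module Defs where

open import Data.Digit using (Bit; 0b; 1b)
open import Data.Fin.Base using (toℕ)
open import Data.List.Base
  using (List; []; _∷_; _++_; length; take; drop; filter; concatMap; applyUpTo)
open import Data.List.Properties
  using (concatMap-++; length-++; length-take; take++drop≡id)
open import Data.Nat.Base using (ℕ; zero; suc; _+_; _*_; _∸_; _≤_; _<_; z≤n; s≤s; >-nonZero)
open import Data.Nat.Properties hiding (_≟_)
open import Data.Product.Base using (∃-syntax; _×_; _,_)
open import Data.Sum.Base using (inj₁; inj₂)
open import Relation.Binary.Definitions using (DecidableEquality)
open import Relation.Binary.PropositionalEquality
open import Relation.Nullary.Decidable using (yes; no)

-- trib k is T_{k-3}, so that the recurrence starts at T_{-3}, T_{-2}, T_{-1}.
trib : ℕ → ℕ
trib 0 = 0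
trib 1 = 0
trib 2 = 1
trib (suc (suc (suc k))) = trib (suc (suc k)) + trib (suc k) + trib k

T : ℕ → ℕ
T n = trib (3 + n)

-- Strings are written most significant digit first: in e_1 ⋯ e_i the digit e_j
-- is followed by i - j further digits.
[_]T : List Bit → ℕ
[ []    ]T = 0
[ e ∷ E ]T = toℕ e * T (length E) + [ E ]T

-- Canonical m E: E records the run of the greedy algorithm on m, possibly
-- with leading zeros.  A digit 1 in position k is produced exactly when T k is
-- the largest Tribonacci number not exceeding what is left of m.
data Canonical : ℕ → List Bit → Set where
  done     : Canonical 0 []
  skip     : ∀ {m E} → m < T (length E) →
             Canonical m E → Canonical m (0b ∷ E)
  subtract : ∀ {m E} → T (length E) ≤ m → m < T (suc (length E)) →
             Canonical (m ∸ T (length E)) E → Canonical m (1b ∷ E)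

dropLast : ∀ {A : Set} → ℕ → List A → List A
dropLast k E = take (length E ∸ k) E

data Letter : Set where
  a b c : Letter

_≟_ : DecidableEquality Letter
a ≟ a = yes refl
a ≟ b = no λ ()
a ≟ c = no λ ()
b ≟ a = no λ ()
b ≟ b = yes refl
b ≟ c = no λ ()
c ≟ a = no λ ()
c ≟ b = no λ ()
c ≟ c = yes refl

τ : Letter → List Letter
τ a = a ∷ b ∷ []
τ b = a ∷ c ∷ []
τ c = a ∷ []

τ* : List Letter → List Letter
τ* = concatMap τ

-- Infinite words t_1 t_2 t_3 ⋯ are functions t with t_{i+1} = t i, and
-- applyUpTo t n is the prefix t_1 ⋯ t_n.  The image of t under τ is the infinite
-- word having all the words τ* (t_1 ⋯ t_n) as prefixes.
IsFixedPoint : (ℕ → Letter) → Set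
IsFixedPoint t = ∀ n →
  applyUpTo t (length (τ* (applyUpTo t n))) ≡ τ* (applyUpTo t n)

IsTribonacciWord : (ℕ → Letter) → Set
IsTribonacciWord t = t 0 ≡ a × IsFixedPoint t

-- N t x n is the number of occurrences of x in t_1 ⋯ t_n.
N : (ℕ → Letter) → Letter → ℕ → ℕ
N t x n = length (filter (x ≟_) (applyUpTo t n))

-- Since T (suc k) ≤ 2 * T k, the greedy algorithm never subtracts T k twice, so
-- it does produce a binary string.
T-suc≤ : ∀ k → T (suc k) ≤ T k + T k
T-suc≤ k = begin
  T k + trib (2 + k) + trib (1 + k)    ≡⟨ +-assoc (T k) _ _ ⟩
  T k + (trib (2 + k) + trib (1 + k))  ≤⟨ +-monoʳ-≤ (T k) (m≤m+n _ (trib k)) ⟩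
  T k + T k                            ∎
  where open ≤-Reasoning

0<trib : ∀ k → 0 < trib (2 + k)
0<trib zero    = s≤s z≤n
0<trib (suc k) = ≤-trans (0<trib k) (≤-trans (m≤m+n _ (trib (1 + k))) (m≤m+n _ (trib k)))

n<T : ∀ n → n < T n
n<T zero    = s≤s z≤n
n<T (suc n) = begin
  2 + n                                ≡⟨ +-comm 1 (suc n) ⟩
  suc n + 1                            ≤⟨ +-mono-≤ (n<T n) (0<trib n) ⟩
  T n + trib (2 + n)                   ≤⟨ m≤m+n _ (trib (1 + n)) ⟩
  T (suc n)                            ∎
  where open ≤-Reasoning

canonical-exists : ∀ k m → m < T k → ∃[ E ] length E ≡ k × Canonical m E
canonical-exists zero    zero    _         = [] , refl , done
canonical-exists zero    (suc _) (s≤s ())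
canonical-exists (suc k) m       m<T with m <? T k
... | yes m<Tk with canonical-exists k m m<Tk
...   | E , refl , can = 0b ∷ E , refl , skip m<Tk can
canonical-exists (suc k) m m<T | no m≮Tk
  with canonical-exists k (m ∸ T k)
         (m<n+o⇒m∸n<o m (T k) {{>-nonZero (≤-<-trans z≤n (n<T k))}}
           (<-≤-trans m<T (T-suc≤ k)))
...   | E , refl , can = 1b ∷ E , refl , subtract (≮⇒≥ m≮Tk) m<T can

canonical-value : ∀ {m E} → Canonical m E → [ E ]T ≡ m
canonical-value done       = refl
canonical-value (skip _ p) = canonical-value p
canonical-value (subtract {m} {E} T≤m _ p) = begin
  1 * T (length E) + [ E ]T              ≡⟨ cong₂ _+_ (*-identityˡ (T (length E))) (canonical-value p) ⟩
  T (length E) + (m ∸ T (length E))      ≡⟨ m+[n∸m]≡n T≤m ⟩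
  m                                      ∎
  where open ≡-Reasoning

-- orbit k is τᵏ(a); each of these words is a prefix of the next one, and
-- tribonacciWord is their limit.
tails : ℕ → List Letter
tails zero    = []
tails (suc k) = b ∷ τ* (tails k)

orbit : ℕ → List Letter
orbit k = a ∷ tails k

at : List Letter → ℕ → Letter
at []       _       = a
at (x ∷ _)  zero    = x
at (_ ∷ xs) (suc i) = at xs i

tribonacciWord : ℕ → Letter
tribonacciWord i = at (orbit i) i

at-++ : ∀ u v {i} → i < length u → at (u ++ v) i ≡ at u i
at-++ (_ ∷ _) v {zero}  _         = refl
at-++ (_ ∷ u) v {suc i} (s≤s i<u) = at-++ u v i<u

applyUpTo-at : ∀ (t : ℕ → Letter) u → (∀ {i} → i < length u → t i ≡ at u i) →
               applyUpTo t (length u) ≡ u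
applyUpTo-at t []      _  = refl
applyUpTo-at t (x ∷ u) eq =
  cong₂ _∷_ (eq (s≤s z≤n)) (applyUpTo-at (λ i → t (suc i)) u (λ i<u → eq (s≤s i<u)))

τ*-length : ∀ u → length u ≤ length (τ* u)
τ*-length []      = z≤n
τ*-length (a ∷ u) = s≤s (m≤n⇒m≤1+n (τ*-length u))
τ*-length (b ∷ u) = s≤s (m≤n⇒m≤1+n (τ*-length u))
τ*-length (c ∷ u) = s≤s (τ*-length u)

orbit-length : ∀ k → k < length (orbit k)
orbit-length zero    = s≤s z≤n
orbit-length (suc k) = s≤s (≤-trans (orbit-length k) (s≤s (τ*-length (tails k))))

tails-mono : ∀ {j k} → j ≤ k → ∃[ v ] tails j ++ v ≡ tails k
tails-mono {k = zero}  z≤n       = [] , refl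
tails-mono {k = suc k} z≤n       = _ , refl
tails-mono {suc j}     (s≤s j≤k) with tails-mono j≤k
... | v , eq = τ* v , cong (b ∷_) (trans (sym (concatMap-++ τ (tails j) v)) (cong τ* eq))

word≡at-orbit : ∀ k {i} → i < length (orbit k) → tribonacciWord i ≡ at (orbit k) i
word≡at-orbit k {i} i<k with ≤-total i k
... | inj₁ i≤k with tails-mono i≤k
...   | v , eq = trans (sym (at-++ (orbit i) v (orbit-length i)))
                       (cong (λ u → at (a ∷ u) i) eq)
word≡at-orbit k {i} i<k | inj₂ k≤i with tails-mono k≤i
...   | v , eq = trans (cong (λ u → at (a ∷ u) i) (sym eq)) (at-++ (orbit k) v i<k)

word-prefix : ∀ k u v → u ++ v ≡ orbit k → applyUpTo tribonacciWord (length u) ≡ u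
word-prefix k u v eq = applyUpTo-at tribonacciWord u λ {i} i<u →
  trans (word≡at-orbit k (<-≤-trans i<u u≤k))
        (trans (cong (λ w → at w i) (sym eq)) (at-++ u v i<u))
  where
  u≤k : length u ≤ length (orbit k)
  u≤k = subst (length u ≤_) (trans (sym (length-++ u)) (cong length eq))
              (m≤m+n (length u) (length v))

tribonacciWord-correct : IsTribonacciWord tribonacciWord
tribonacciWord-correct = refl , fixed
  where
  fixed : IsFixedPoint tribonacciWord
  fixed n = subst (λ w → applyUpTo tribonacciWord (length (τ* w)) ≡ τ* w) (sym prefix≡)
    (word-prefix (suc n) (τ* u) (τ* v)
      (trans (sym (concatMap-++ τ u v)) (cong τ* u++v)))
    where
    u v : List Letter
    u = take n (orbit n)
    v = drop n (orbit n)
    u++v : u ++ v ≡ orbit n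
    u++v = take++drop≡id n (orbit n)
    ∣u∣ : length u ≡ n
    ∣u∣ = trans (length-take n (orbit n)) (m≤n⇒m⊓n≡m (<⇒≤ (orbit-length n)))
    prefix≡ : applyUpTo tribonacciWord n ≡ u
    prefix≡ = trans (cong (applyUpTo tribonacciWord) (sym ∣u∣)) (word-prefix n u v u++v)

{-# OPTIONS --safe #-}
module Submission where

-- Write L m for the length of τ* (t_1 ⋯ t_m), so that t_1 ⋯ t_{L m} is the
-- image of t_1 ⋯ t_m and is followed by τ (t_{m+1}).
--
-- A string without 111 drives an automaton on the letters, which starts in a:
-- from y the digit d leads to the letter number d of τ y.  The heart of the
-- proof (letter-at-value, counts-at-value) is that E then computes the prefix of
-- the word of length [ E ]T.  Namely t at index [ E ]T is the state reached,
-- the prefix contains Σ e_j T_{i-j-1} letters a and Σ e_j T_{i-j-2} letters b,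
-- and appending a digit d turns the length m = [ F ]T into L m + d
-- (value-as-image).  All this is a single induction on E from the right, in
-- which the recurrence of the Tribonacci numbers matches
-- L m = m + N_a(m) + N_b(m).
--
-- Let m = [ F ]T, where F d is the representation at hand.  As every τ y has
-- exactly one a, a b only if y is a, and a c only if y is b, the count of a, b
-- or c in the prefix of length L q is q, N_a(q) or N_b(q).  The prefixes in
-- question end a few letters after L m, and inspecting these letters gives
--   N_a(1 + [ F d ]T) = m + 1,
--   N_b(2 + [ F d ]T) = N_a(1 + m),
--   N_c(4 + [ F d ]T) = N_b(2 + m).
-- These are chained, dropping one digit of the representation each time.

open import Defs
open import Data.Digit using (Bit; 0b; 1b)
open import Data.Fin.Base using (zero; suc; toℕ)
open import Data.List.Base
  using (List; []; _∷_; _++_; _∷ʳ_; length; take; filter; applyUpTo)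
open import Data.List.Properties
  using ( concatMap-++; length-++; length-++-sucʳ; ++-identityʳ; ++-assoc; ++-cancelˡ
        ; ∷-injective; ∷-injectiveˡ; filter-++; filter-accept; filter-reject
        ; applyUpTo-∷ʳ; length-applyUpTo; take-all)
open import Data.Nat.Base
  using (ℕ; zero; suc; _+_; _*_; _∸_; _≤_; _<_; z≤n; s≤s; >-nonZero)
open import Data.Nat.Properties
  using ( +-identityʳ; +-assoc; +-comm; +-suc; *-identityʳ; *-zeroʳ
        ; m≤m+n; m∸n≤m; m+[n∸m]≡n; m<n+o⇒m∸n<o; ≤-refl; ≤-trans; ≤-reflexive; <-≤-trans; <⇒≱)
open import Data.Nat.Tactic.RingSolver using (solve-∀)
open import Data.Product.Base using (∃-syntax; _×_; _,_; proj₁; proj₂)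
open import Data.Sum.Base using (_⊎_; inj₁; inj₂)
open import Relation.Binary.PropositionalEquality
  using (_≡_; _≢_; refl; sym; trans; cong; cong₂; subst; module ≡-Reasoning)
open import Relation.Nullary using (contradiction)

open ≡-Reasoning

-- Shifted values of a string

-- value s E is Σ e_j T_{i-j+s-3}: the value of E with its digits moved s - 3
-- places to the left, where T_{-3}, T_{-2}, T_{-1} are available for s < 3.
value : ℕ → List Bit → ℕ
value s []      = 0
value s (e ∷ E) = toℕ e * trib (s + length E) + value s E

value-3 : ∀ E → [ E ]T ≡ value 3 E
value-3 []      = refl
value-3 (e ∷ E) = cong (toℕ e * T (length E) +_) (value-3 E)

value-rec : ∀ s E → value (3 + s) E ≡ value (2 + s) E + value (1 + s) E + value s E
value-rec s []      = refl
value-rec s (e ∷ E) = begin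
  toℕ e * (x + y + z) + value (3 + s) E
    ≡⟨ cong (toℕ e * (x + y + z) +_) (value-rec s E) ⟩
  toℕ e * (x + y + z) + (value (2 + s) E + value (1 + s) E + value s E)
    ≡⟨ regroup (toℕ e) x y z _ _ _ ⟩
  (toℕ e * x + value (2 + s) E) + (toℕ e * y + value (1 + s) E) + (toℕ e * z + value s E) ∎
  where
  k x y z : ℕ
  k = s + length E
  x = trib (2 + k)
  y = trib (1 + k)
  z = trib k
  regroup : ∀ e x y z p q r →
    e * (x + y + z) + (p + q + r) ≡ (e * x + p) + (e * y + q) + (e * z + r)
  regroup = solve-∀

length-∷ʳ : ∀ {A : Set} (xs : List A) x → length (xs ∷ʳ x) ≡ suc (length xs)
length-∷ʳ xs x = trans (length-++-sucʳ xs x []) (cong (λ ys → suc (length ys)) (++-identityʳ xs))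

value-∷ʳ : ∀ s F d → value s (F ∷ʳ d) ≡ value (suc s) F + toℕ d * trib s
value-∷ʳ s []      d =
  trans (+-identityʳ _) (cong (λ k → toℕ d * trib k) (+-identityʳ s))
value-∷ʳ s (e ∷ F) d = begin
  toℕ e * trib (s + length (F ∷ʳ d)) + value s (F ∷ʳ d)
    ≡⟨ cong₂ (λ k v → toℕ e * trib k + v)
             (trans (cong (s +_) (length-∷ʳ F d)) (+-suc s (length F)))
             (value-∷ʳ s F d) ⟩
  toℕ e * trib (suc s + length F) + (value (suc s) F + toℕ d * trib s)
    ≡⟨ sym (+-assoc (toℕ e * trib (suc s + length F)) _ _) ⟩
  value (suc s) (e ∷ F) + toℕ d * trib s ∎

dropLast-∷ʳ : ∀ {A : Set} k (xs : List A) x → dropLast (suc k) (xs ∷ʳ x) ≡ dropLast k xs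
dropLast-∷ʳ k xs x = trans (cong (λ l → take (l ∸ suc k) (xs ∷ʳ x)) (length-∷ʳ xs x))
                           (take-∷ʳ (length xs ∸ k) xs (m∸n≤m (length xs) k))
  where
  take-∷ʳ : ∀ n ys → n ≤ length ys → take n (ys ∷ʳ x) ≡ take n ys
  take-∷ʳ zero    ys       _         = refl
  take-∷ʳ (suc n) (y ∷ ys) (s≤s n≤l) = cong (y ∷_) (take-∷ʳ n ys n≤l)

dropLast-0 : ∀ {A : Set} (xs : List A) → dropLast 0 xs ≡ xs
dropLast-0 xs = take-all (length xs) xs ≤-refl

-- The automaton of the representations

-- Step y d x: the letter number d of τ y, counted from 0, exists and is x.
data Step : Letter → Bit → Letter → Set where
  first   : ∀ {y} → Step y 0b a
  secondᵃ : Step a 1b b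
  secondᵇ : Step b 1b c

-- Reaches E x: reading E from the initial state a ends in x.  The letter x
-- records how many digits 1 end E: none for a, one for b and two for c, so that
-- the strings read are those without 111.
data Reaches : List Bit → Letter → Set where
  start : Reaches [] a
  _▹_   : ∀ {F y d x} → Reaches F y → Step y d x → Reaches (F ∷ʳ d) x

-- The length of τᵏ(x).  A greedy string of length k can be read from x when its
-- value is below room x k.
room : Letter → ℕ → ℕ
room a k = T k
room b k = trib (2 + k) + trib (1 + k)
room c k = trib (2 + k)

canonical-< : ∀ {m E} → Canonical m E → m < T (length E)
canonical-< done                     = s≤s z≤n
canonical-< (skip m<T _)             =
  <-≤-trans m<T (≤-trans (m≤m+n _ _) (m≤m+n _ _))
canonical-< (subtract _ m<T _)       = m<T

-- The bound passes from a to b and from b to c by subtracting the Tribonacci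
-- number of the digit 1 just read, and it forbids a digit 1 in state c: as
-- T_k + T_{k+1} + T_{k+2} = T_{k+3}, the greedy algorithm would have subtracted
-- T_{k+3} instead of three terms.
canonical-reaches-from : ∀ {F x m E} → Reaches F x → m < room x (length E) →
                         Canonical m E → ∃[ y ] Reaches (F ++ E) y
canonical-reaches-from {F} {x} r _ done =
  x , subst (λ E → Reaches E x) (sym (++-identityʳ F)) r
canonical-reaches-from {F} r _ (skip {E = E} m<T can)
  with y , r′ ← canonical-reaches-from (r ▹ first) m<T can
  = y , subst (λ G → Reaches G y) (++-assoc F (0b ∷ []) E) r′
canonical-reaches-from {F} {a} {m} r m<room (subtract {E = E} _ _ can)
  with y , r′ ← canonical-reaches-from (r ▹ secondᵃ)
         (m<n+o⇒m∸n<o m (T (length E))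
           {{>-nonZero (<-≤-trans (0<trib (length E)) (m≤m+n _ _))}}
           (subst (m <_) (+-assoc (T (length E)) _ _) m<room)) can
  = y , subst (λ G → Reaches G y) (++-assoc F (1b ∷ []) E) r′
canonical-reaches-from {F} {b} {m} r m<room (subtract {E = E} _ _ can)
  with y , r′ ← canonical-reaches-from (r ▹ secondᵇ)
         (m<n+o⇒m∸n<o m (T (length E)) {{>-nonZero (0<trib (length E))}} m<room) can
  = y , subst (λ G → Reaches G y) (++-assoc F (1b ∷ []) E) r′
canonical-reaches-from {x = c} r m<room (subtract T≤m _ _) = contradiction T≤m (<⇒≱ m<room)

canonical-reaches : ∀ {m E} → Canonical m E → ∃[ x ] Reaches E x
canonical-reaches can = canonical-reaches-from start (canonical-< can) can

-- Letter counts of images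

count : Letter → List Letter → ℕ
count x w = length (filter (x ≟_) w)

count-a-τ* : ∀ w → count a (τ* w) ≡ length w
count-a-τ* []      = refl
count-a-τ* (a ∷ w) = cong suc (count-a-τ* w)
count-a-τ* (b ∷ w) = cong suc (count-a-τ* w)
count-a-τ* (c ∷ w) = cong suc (count-a-τ* w)

count-b-τ* : ∀ w → count b (τ* w) ≡ count a w
count-b-τ* []      = refl
count-b-τ* (a ∷ w) = cong suc (count-b-τ* w)
count-b-τ* (b ∷ w) = count-b-τ* w
count-b-τ* (c ∷ w) = count-b-τ* w

count-c-τ* : ∀ w → count c (τ* w) ≡ count b w
count-c-τ* []      = refl
count-c-τ* (a ∷ w) = count-c-τ* w
count-c-τ* (b ∷ w) = cong suc (count-c-τ* w)
count-c-τ* (c ∷ w) = count-c-τ* w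

length-τ* : ∀ w → length (τ* w) ≡ length w + count a w + count b w
length-τ* []      = refl
length-τ* (a ∷ w) = trans (cong (2 +_) (length-τ* w))
  (cong (λ n → suc (n + count b w)) (sym (+-suc (length w) (count a w))))
length-τ* (b ∷ w) = trans (cong (2 +_) (length-τ* w))
  (cong suc (sym (+-suc (length w + count a w) (count b w))))
length-τ* (c ∷ w) = cong suc (length-τ* w)

module _ (t : ℕ → Letter) where

  count-suc : ∀ x n → N t x (suc n) ≡ N t x n + count x (t n ∷ [])
  count-suc x n = begin
    count x (applyUpTo t (suc n))
      ≡⟨ cong (count x) (sym (applyUpTo-∷ʳ t n)) ⟩
    length (filter (x ≟_) (applyUpTo t n ∷ʳ t n))
      ≡⟨ cong length (filter-++ (x ≟_) (applyUpTo t n) (t n ∷ [])) ⟩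
    length (filter (x ≟_) (applyUpTo t n) ++ filter (x ≟_) (t n ∷ []))
      ≡⟨ length-++ (filter (x ≟_) (applyUpTo t n)) ⟩
    N t x n + count x (t n ∷ []) ∎

  N-suc-≡ : ∀ {x n} → t n ≡ x → N t x (suc n) ≡ suc (N t x n)
  N-suc-≡ {x} {n} t≡x = begin
    N t x (suc n)                  ≡⟨ count-suc x n ⟩
    N t x n + count x (t n ∷ [])
      ≡⟨ cong (λ l → N t x n + length l) (filter-accept (x ≟_) (sym t≡x)) ⟩
    N t x n + 1                    ≡⟨ +-comm (N t x n) 1 ⟩
    suc (N t x n)                  ∎

  N-suc-≢ : ∀ {x y n} → t n ≡ y → x ≢ y → N t x (suc n) ≡ N t x n
  N-suc-≢ {x} {y} {n} t≡y x≢y = begin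
    N t x (suc n)                  ≡⟨ count-suc x n ⟩
    N t x n + count x (t n ∷ [])
      ≡⟨ cong (λ l → N t x n + length l)
              (filter-reject (x ≟_) (λ x≡t → x≢y (trans x≡t t≡y))) ⟩
    N t x n + 0                    ≡⟨ +-identityʳ (N t x n) ⟩
    N t x n                        ∎

-- Fixed points of τ

applyUpTo-+ : ∀ {A : Set} (f : ℕ → A) m n →
              applyUpTo f (m + n) ≡ applyUpTo f m ++ applyUpTo (λ i → f (m + i)) n
applyUpTo-+ f zero    n = refl
applyUpTo-+ f (suc m) n = cong (f 0 ∷_) (applyUpTo-+ (λ i → f (suc i)) m n)

module FixedPoint (t : ℕ → Letter) (fixed : IsFixedPoint t) where

  prefix : ℕ → List Letter
  prefix = applyUpTo t

  -- The index at which the image of t_{m+1} begins.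
  L : ℕ → ℕ
  L m = length (τ* (prefix m))

  L-formula : ∀ m → L m ≡ m + N t a m + N t b m
  L-formula m = trans (length-τ* (prefix m))
    (cong (λ l → l + N t a m + N t b m) (length-applyUpTo t m))

  N-a-L : ∀ m → N t a (L m) ≡ m
  N-a-L m = trans (cong (count a) (fixed m)) (trans (count-a-τ* (prefix m)) (length-applyUpTo t m))

  N-b-L : ∀ m → N t b (L m) ≡ N t a m
  N-b-L m = trans (cong (count b) (fixed m)) (count-b-τ* (prefix m))

  N-c-L : ∀ m → N t c (L m) ≡ N t b m
  N-c-L m = trans (cong (count c) (fixed m)) (count-c-τ* (prefix m))

  τ*-prefix-suc : ∀ {m y} → t m ≡ y → τ* (prefix (suc m)) ≡ τ* (prefix m) ++ τ y
  τ*-prefix-suc {m} {y} refl = begin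
    τ* (prefix (suc m))             ≡⟨ cong τ* (sym (applyUpTo-∷ʳ t m)) ⟩
    τ* (prefix m ∷ʳ y)              ≡⟨ concatMap-++ τ (prefix m) (y ∷ []) ⟩
    τ* (prefix m) ++ (τ y ++ [])    ≡⟨ cong (τ* (prefix m) ++_) (++-identityʳ (τ y)) ⟩
    τ* (prefix m) ++ τ y            ∎

  L-suc : ∀ {m y} → t m ≡ y → L (suc m) ≡ L m + length (τ y)
  L-suc {m} tm = trans (cong length (τ*-prefix-suc tm)) (length-++ (τ* (prefix m)))

  factor : ∀ {m y} → t m ≡ y → applyUpTo (λ i → t (L m + i)) (length (τ y)) ≡ τ y
  factor {m} {y} tm = ++-cancelˡ (τ* (prefix m)) _ _ (begin
    τ* (prefix m) ++ rest        ≡⟨ cong (_++ rest) (sym (fixed m)) ⟩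
    prefix (L m) ++ rest         ≡⟨ sym (applyUpTo-+ t (L m) (length (τ y))) ⟩
    prefix (L m + length (τ y))  ≡⟨ cong prefix (sym (L-suc tm)) ⟩
    prefix (L (suc m))           ≡⟨ fixed (suc m) ⟩
    τ* (prefix (suc m))          ≡⟨ τ*-prefix-suc tm ⟩
    τ* (prefix m) ++ τ y         ∎)
    where
    rest : List Letter
    rest = applyUpTo (λ i → t (L m + i)) (length (τ y))

  letter-in-factor : ∀ {m y d x} → t m ≡ y → Step y d x → t (L m + toℕ d) ≡ x
  letter-in-factor {y = a} tm first   = ∷-injectiveˡ (factor tm)
  letter-in-factor {y = b} tm first   = ∷-injectiveˡ (factor tm)
  letter-in-factor {y = c} tm first   = ∷-injectiveˡ (factor tm)
  letter-in-factor         tm secondᵃ = ∷-injectiveˡ (proj₂ (∷-injective (factor tm)))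
  letter-in-factor         tm secondᵇ = ∷-injectiveˡ (proj₂ (∷-injective (factor tm)))

  t-L : ∀ m → t (L m) ≡ a
  t-L m = trans (cong t (sym (+-identityʳ (L m)))) (letter-in-factor {m} refl first)

  -- Counts up to L m + d for a bit d: the letter at L m, if included, is an a.

  N-a-L+bit : ∀ m (d : Bit) → N t a (L m + toℕ d) ≡ m + toℕ d
  N-a-L+bit m zero       rewrite +-identityʳ (L m) = trans (N-a-L m) (sym (+-identityʳ m))
  N-a-L+bit m (suc zero) rewrite +-comm (L m) 1 | +-comm m 1 =
    trans (N-suc-≡ t (t-L m)) (cong suc (N-a-L m))

  N-b-L+bit : ∀ m (d : Bit) → N t b (L m + toℕ d) ≡ N t a m
  N-b-L+bit m zero       rewrite +-identityʳ (L m) = N-b-L m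
  N-b-L+bit m (suc zero) rewrite +-comm (L m) 1 =
    trans (N-suc-≢ t (t-L m) (λ ())) (N-b-L m)

  N-c-L+bit : ∀ m (d : Bit) → N t c (L m + toℕ d) ≡ N t b m
  N-c-L+bit m zero       rewrite +-identityʳ (L m) = N-c-L m
  N-c-L+bit m (suc zero) rewrite +-comm (L m) 1 =
    trans (N-suc-≢ t (t-L m) (λ ())) (N-c-L m)

  -- Every index is the first one of an image τ (t_{m+1}) or the last one.
  first-or-last : ∀ i → ∃[ m ] (i ≡ L m ⊎ suc i ≡ L (suc m))
  first-or-last zero    = 0 , inj₁ refl
  first-or-last (suc i) with first-or-last i
  ... | m , inj₂ last = suc m , inj₁ last
  ... | m , inj₁ refl with t m in tm
  ...   | a = m , inj₂ (trans (+-comm 2 (L m)) (sym (L-suc tm)))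
  ...   | b = m , inj₂ (trans (+-comm 2 (L m)) (sym (L-suc tm)))
  ...   | c = suc m , inj₁ (trans (+-comm 1 (L m)) (sym (L-suc tm)))

  after-c : ∀ {i} → t i ≡ c → t (suc i) ≡ a
  after-c {i} ti with first-or-last i
  ... | m , inj₁ refl = contradiction (trans (sym (t-L m)) ti) λ ()
  ... | m , inj₂ last = trans (cong t last) (t-L (suc m))

  -- Two places beyond index 0 or 1 of the image of t_{m+1} is index 0 or 1 after
  -- that image; a shorter image, τ c, has index 0 only.
  two-further : ∀ {m y d x} → t m ≡ y → Step y d x →
                ∃[ d′ ] (2 + (L m + toℕ d) ≡ L (suc m) + toℕ {2} d′)
  two-further {m} {y} {d} tm s = by-letter y d s (L-suc tm)
    where
    long : ∀ l e → 2 + (l + e) ≡ l + 2 + e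
    long = solve-∀
    short : ∀ l → 2 + (l + 0) ≡ l + 1 + 1
    short = solve-∀
    by-letter : ∀ y d {x} → Step y d x → L (suc m) ≡ L m + length (τ y) →
                ∃[ d′ ] (2 + (L m + toℕ d) ≡ L (suc m) + toℕ {2} d′)
    by-letter a d  _     eq = d , trans (long (L m) (toℕ d)) (cong (_+ toℕ d) (sym eq))
    by-letter b d  _     eq = d , trans (long (L m) (toℕ d)) (cong (_+ toℕ d) (sym eq))
    by-letter c _  first eq = 1b , trans (short (L m)) (cong (_+ 1) (sym eq))

  -- Only the last of the letters counted is in doubt; it is an a exactly if d is 0.
  N-a-step : ∀ {m y d x} → t m ≡ y → Step y d x → N t a (1 + (L m + toℕ d)) ≡ m + 1
  N-a-step {m} tm first   = trans (N-suc-≡ t (letter-in-factor {m} tm first))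
    (trans (cong suc (N-a-L+bit m 0b)) (sym (+-suc m 0)))
  N-a-step {m} tm secondᵃ =
    trans (N-suc-≢ t (letter-in-factor {m} tm secondᵃ) (λ ())) (N-a-L+bit m 1b)
  N-a-step {m} tm secondᵇ =
    trans (N-suc-≢ t (letter-in-factor {m} tm secondᵇ) (λ ())) (N-a-L+bit m 1b)

  N-b-step : ∀ {m y d x} → t m ≡ y → Step y d x →
             N t b (2 + (L m + toℕ d)) ≡ N t a (suc m)
  N-b-step {m} tm s with two-further tm s
  ... | d′ , eq = trans (cong (N t b) eq) (N-b-L+bit (suc m) d′)

  N-c-two-further : ∀ m (d : Bit) → N t c (2 + (L m + toℕ d)) ≡ N t b (suc m)
  N-c-two-further m d with possible d
    where
    possible : ∀ d → (∃[ x ] Step (t m) d x) ⊎ (d ≡ 1b × t m ≡ c)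
    possible zero       = inj₁ (a , first)
    possible (suc zero) with t m
    ... | a = inj₁ (b , secondᵃ)
    ... | b = inj₁ (c , secondᵇ)
    ... | c = inj₂ (refl , refl)
  ... | inj₁ (_ , s) with two-further {m} refl s
  ...   | d′ , eq = trans (cong (N t c) eq) (N-c-L+bit (suc m) d′)
  -- If t_{m+1} = c then t_{m+2} = a, and τ* (ca) occupies exactly the three
  -- indices from L m to L m + 2.
  N-c-two-further m d | inj₂ (refl , tm) = begin
    N t c (2 + (L m + 1))    ≡⟨ cong (N t c) exhausted ⟩
    N t c (L (2 + m))        ≡⟨ N-c-L (2 + m) ⟩
    N t b (2 + m)            ≡⟨ N-suc-≢ t {b} (after-c tm) (λ ()) ⟩
    N t b (suc m)            ∎
    where
    exhausted : 2 + (L m + 1) ≡ L (2 + m)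
    exhausted = begin
      2 + (L m + 1)    ≡⟨ +-comm 2 (L m + 1) ⟩
      L m + 1 + 2      ≡⟨ cong (_+ 2) (sym (L-suc tm)) ⟩
      L (suc m) + 2    ≡⟨ sym (L-suc (after-c tm)) ⟩
      L (2 + m)        ∎

  N-c-step : ∀ {m y d x} → t m ≡ y → Step y d x →
             N t c (4 + (L m + toℕ d)) ≡ N t b (2 + m)
  N-c-step {m} tm s with two-further tm s
  ... | d′ , eq = trans (cong (λ n → N t c (2 + n)) eq) (N-c-two-further (suc m) d′)

  -- Prefixes of length [ E ]T

  -- The prefix of length [ E ]T has Σ e_j T_{i-j-1} letters a and Σ e_j T_{i-j-2}
  -- letters b.
  CountsAtValue : List Bit → Set
  CountsAtValue E = N t a [ E ]T ≡ value 2 E × N t b [ E ]T ≡ value 1 E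

  value-as-image : ∀ F d → CountsAtValue F → [ F ∷ʳ d ]T ≡ L [ F ]T + toℕ d
  value-as-image F d (Na , Nb) = begin
    [ F ∷ʳ d ]T                                  ≡⟨ value-3 (F ∷ʳ d) ⟩
    value 3 (F ∷ʳ d)                             ≡⟨ value-∷ʳ 3 F d ⟩
    value 4 F + toℕ d * 1
      ≡⟨ cong₂ _+_ (value-rec 1 F) (*-identityʳ (toℕ d)) ⟩
    value 3 F + value 2 F + value 1 F + toℕ d
      ≡⟨ cong (_+ toℕ d) (sym (cong₂ _+_ (cong₂ _+_ (value-3 F) Na) Nb)) ⟩
    [ F ]T + N t a [ F ]T + N t b [ F ]T + toℕ d
      ≡⟨ cong (_+ toℕ d) (sym (L-formula [ F ]T)) ⟩
    L [ F ]T + toℕ d                             ∎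

  counts-at-value : ∀ {E x} → Reaches E x → CountsAtValue E
  counts-at-value start = refl , refl
  counts-at-value (_▹_ {F} {d = d} r _) = Na , Nb
    where
    ih : CountsAtValue F
    ih = counts-at-value r
    Na : N t a [ F ∷ʳ d ]T ≡ value 2 (F ∷ʳ d)
    Na = begin
      N t a [ F ∷ʳ d ]T            ≡⟨ cong (N t a) (value-as-image F d ih) ⟩
      N t a (L [ F ]T + toℕ d)     ≡⟨ N-a-L+bit [ F ]T d ⟩
      [ F ]T + toℕ d               ≡⟨ cong₂ _+_ (value-3 F) (sym (*-identityʳ (toℕ d))) ⟩
      value 3 F + toℕ d * trib 2   ≡⟨ sym (value-∷ʳ 2 F d) ⟩
      value 2 (F ∷ʳ d)             ∎
    Nb : N t b [ F ∷ʳ d ]T ≡ value 1 (F ∷ʳ d)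
    Nb = begin
      N t b [ F ∷ʳ d ]T            ≡⟨ cong (N t b) (value-as-image F d ih) ⟩
      N t b (L [ F ]T + toℕ d)     ≡⟨ N-b-L+bit [ F ]T d ⟩
      N t a [ F ]T                 ≡⟨ proj₁ ih ⟩
      value 2 F                    ≡⟨ sym (+-identityʳ (value 2 F)) ⟩
      value 2 F + 0                ≡⟨ cong (value 2 F +_) (sym (*-zeroʳ (toℕ d))) ⟩
      value 2 F + toℕ d * trib 1   ≡⟨ sym (value-∷ʳ 1 F d) ⟩
      value 1 (F ∷ʳ d)             ∎

  value-of-▹ : ∀ {F x} d → Reaches F x → [ F ∷ʳ d ]T ≡ L [ F ]T + toℕ d
  value-of-▹ {F} d r = value-as-image F d (counts-at-value r)

  letter-at-value : t 0 ≡ a → ∀ {E x} → Reaches E x → t [ E ]T ≡ x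
  letter-at-value t₀ start = t₀
  letter-at-value t₀ (_▹_ {F} {d = d} r s) =
    trans (cong t (value-of-▹ d r)) (letter-in-factor {[ F ]T} (letter-at-value t₀ r) s)

  -- The three counts

  module _ (t₀ : t 0 ≡ a) where

    N-a-at : ∀ {E x} → Reaches E x → 1 ≤ length E →
             N t a (1 + [ E ]T) ≡ [ dropLast 1 E ]T + 1
    N-a-at (_▹_ {F} {d = d} r s) _ = begin
      N t a (1 + [ F ∷ʳ d ]T)             ≡⟨ cong (λ n → N t a (1 + n)) (value-of-▹ d r) ⟩
      N t a (1 + (L [ F ]T + toℕ d))      ≡⟨ N-a-step (letter-at-value t₀ r) s ⟩
      [ F ]T + 1
        ≡⟨ cong (λ G → [ G ]T + 1) (sym (trans (dropLast-∷ʳ 0 F d) (dropLast-0 F))) ⟩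
      [ dropLast 1 (F ∷ʳ d) ]T + 1        ∎

    shorter : ∀ {k} (F : List Bit) d → suc k ≤ length (F ∷ʳ d) → k ≤ length F
    shorter F d k<l with s≤s k≤l ← ≤-trans k<l (≤-reflexive (length-∷ʳ F d)) = k≤l

    N-b-at : ∀ {E x} → Reaches E x → 2 ≤ length E →
             N t b (2 + [ E ]T) ≡ [ dropLast 2 E ]T + 1
    N-b-at (_▹_ {F} {d = d} r s) 2≤l = begin
      N t b (2 + [ F ∷ʳ d ]T)             ≡⟨ cong (λ n → N t b (2 + n)) (value-of-▹ d r) ⟩
      N t b (2 + (L [ F ]T + toℕ d))      ≡⟨ N-b-step (letter-at-value t₀ r) s ⟩
      N t a (1 + [ F ]T)                  ≡⟨ N-a-at r (shorter F d 2≤l) ⟩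
      [ dropLast 1 F ]T + 1               ≡⟨ cong (λ G → [ G ]T + 1) (sym (dropLast-∷ʳ 1 F d)) ⟩
      [ dropLast 2 (F ∷ʳ d) ]T + 1        ∎

    N-c-at : ∀ {E x} → Reaches E x → 3 ≤ length E →
             N t c (4 + [ E ]T) ≡ [ dropLast 3 E ]T + 1
    N-c-at (_▹_ {F} {d = d} r s) 3≤l = begin
      N t c (4 + [ F ∷ʳ d ]T)             ≡⟨ cong (λ n → N t c (4 + n)) (value-of-▹ d r) ⟩
      N t c (4 + (L [ F ]T + toℕ d))      ≡⟨ N-c-step (letter-at-value t₀ r) s ⟩
      N t b (2 + [ F ]T)                  ≡⟨ N-b-at r (shorter F d 3≤l) ⟩
      [ dropLast 2 F ]T + 1               ≡⟨ cong (λ G → [ G ]T + 1) (sym (dropLast-∷ʳ 2 F d)) ⟩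
      [ dropLast 3 (F ∷ʳ d) ]T + 1        ∎

canonical-shifted : ∀ {k n E} → k ≤ n → Canonical (n ∸ k) E → n ≡ k + [ E ]T
canonical-shifted {k} k≤n can =
  trans (sym (m+[n∸m]≡n k≤n)) (cong (k +_) (sym (canonical-value can)))

theorem13 : (t : ℕ → Letter) → IsTribonacciWord t → (n : ℕ) →
    (1 ≤ n → (e : List Bit) → 1 ≤ length e → Canonical (n ∸ 1) e →
    N t a n ≡ [ dropLast 1 e ]T + 1) ×
    (2 ≤ n → (f : List Bit) → 2 ≤ length f → Canonical (n ∸ 2) f →
    N t b n ≡ [ dropLast 2 f ]T + 1) ×
    (4 ≤ n → (g : List Bit) → 3 ≤ length g → Canonical (n ∸ 4) g →
    N t c n ≡ [ dropLast 3 g ]T + 1)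
theorem13 t (t₀ , fixed) n =
    (λ 1≤n e 1≤l can → trans (cong (N t a) (canonical-shifted 1≤n can))
                             (N-a-at t₀ (proj₂ (canonical-reaches can)) 1≤l))
  , (λ 2≤n f 2≤l can → trans (cong (N t b) (canonical-shifted 2≤n can))
                             (N-b-at t₀ (proj₂ (canonical-reaches can)) 2≤l))
  , (λ 4≤n g 3≤l can → trans (cong (N t c) (canonical-shifted 4≤n can))
                             (N-c-at t₀ (proj₂ (canonical-reaches can)) 3≤l))
  where open FixedPoint t fixed
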